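{- Let $n\ge 1$ and $0\le k\le n-1$. Let $\mathcal{P}(n+k-1,k)$ be the set of partial matchings of $[n+k-1]$ with exactly $k$ arcs that contain no $2$-right crossings and no right nestings, and let $\mathcal{CT}(n,k)$ be the set of set partitions of $[n]$ with exactly $k$ arcs that contain no right crossings. Then there is a bijection from $\mathcal{P}(n+k-1,k)$ to $\mathcal{CT}(n,k)$ which transforms the number of neighbor alignments of a partial matching into the number of transients of a partition; that is, for every $M\in\mathcal{P}(n+k-1,k)$, the number of neighbor alignments of $M$ equals the number of transients of its image.
   Context: $[m]=\{1,2,\ldots,m\}$, with $[0]=\emptyset$ (which has exactly one partition, the empty one). The arcs of a set partition $\pi$ of $[m]$ are those of its linear representation: for each block $\{i_1<i_2<\cdots<i_r\}$ of $\pi$, the arcs are the pairs $(i_1,i_2),(i_2,i_3),\ldots,(i_{r-1},i_r)$ (a singleton block gives no arc). A partial matching is a set partition in which every block has at most two elements. For a set partition (in particular a partial matching), with all arcs below belonging to it: - a right nesting is a pair of arcs $(i_1,j_1)$, $(i_2,j_2)$ with $i_1<i_2<j_2<j_1$ and $j_1=j_2+1$; - a right crossing is a pair of arcs $(i_1,j_1)$, $(i_2,j_2)$ with $i_1<i_2<j_1<j_2$ and $j_2=j_1+1$; - a $2$-right crossing is a pair of arcs $(i_1,j_1)$, $(i_2,j_2)$ with $i_1<i_2<j_1<j_2$ and $j_2-j_1\le 2$; - a neighbor alignment is a pair of arcs $(i_1,j_1)$, $(i_2,j_2)$ with $i_2=j_1+1$; - a transient is a vertex $j$ for which there are arcs $(i,j)$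 and $(j,k)$ with $i<j<k$. -}

module Defs where

open import Level using (0ℓ) renaming (suc to lsuc)
open import Data.Nat as ℕ using (ℕ; _∸_)
import Data.Nat.Properties as ℕ
open import Data.Bool.Properties using () renaming (_≟_ to _≟ᵇ_)
open import Data.Fin using (Fin; toℕ; _<_)
open import Data.Fin.Properties using (_<?_; any?; all?)
open import Data.Fin.Subset using (Subset; _∈_; Nonempty; ∣_∣)
open import Data.Fin.Subset.Properties using (_∈?_; nonempty?; anySubset?)
open import Data.List using (List; length; filter; allFin; cartesianProduct)
open import Data.Product using (_×_; _,_; ∃!; ∃-syntax)
open import Data.Vec.Properties using (≡-dec)
open import Relation.Binary using (Setoid)
import Relation.Binary.Construct.On as On
open import Relation.Binary.PropositionalEquality using (_≡_; subst)
open import Relation.Nullary using (Dec; yes; no; ¬_)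
open import Relation.Nullary.Decidable using (map′; ¬?; _×-dec_)
open import Relation.Unary using (Pred; Decidable)
open import Relation.Unary.Relation.Binary.Equality using (≐-setoid)

-- The vertex set {1,…,m} is represented by Fin m (vertex v as v ∸ 1); every
-- notion below depends only on the order and on differences of vertices.

record SetPartition (m : ℕ) : Set₁ where
  field
    IsBlock  : Pred (Subset m) 0ℓ
    nonempty : ∀ {B} → IsBlock B → Nonempty B
    cover    : ∀ i → ∃! _≡_ λ B → IsBlock B × i ∈ B

open SetPartition public

-- Two partitions are equal when they have the same blocks.
SetPartitions : ℕ → Setoid (lsuc 0ℓ) 0ℓ
SetPartitions m = On.setoid (≐-setoid (Subset m) 0ℓ) IsBlock

IsPartialMatching : ∀ {m} → SetPartition m → Set
IsPartialMatching π = ∀ {B} → IsBlock π B → ∣ B ∣ ℕ.≤ 2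

Arc : ∀ {m} → SetPartition m → Fin m → Fin m → Set
Arc π i j = ∃[ B ] IsBlock π B × i ∈ B × j ∈ B × i < j ×
                   (∀ k → ¬ (k ∈ B × i < k × k < j))

RightNesting : ∀ {m} → SetPartition m → Set
RightNesting π = ∃[ i₁ ] ∃[ j₁ ] ∃[ i₂ ] ∃[ j₂ ] Arc π i₁ j₁ × Arc π i₂ j₂ ×
  i₁ < i₂ × i₂ < j₂ × j₂ < j₁ × toℕ j₁ ≡ ℕ.suc (toℕ j₂)

RightCrossing : ∀ {m} → SetPartition m → Set
RightCrossing π = ∃[ i₁ ] ∃[ j₁ ] ∃[ i₂ ] ∃[ j₂ ] Arc π i₁ j₁ × Arc π i₂ j₂ ×
  i₁ < i₂ × i₂ < j₁ × j₁ < j₂ × toℕ j₂ ≡ ℕ.suc (toℕ j₁)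

2-RightCrossing : ∀ {m} → SetPartition m → Set
2-RightCrossing π = ∃[ i₁ ] ∃[ j₁ ] ∃[ i₂ ] ∃[ j₂ ] Arc π i₁ j₁ × Arc π i₂ j₂ ×
  i₁ < i₂ × i₂ < j₁ × j₁ < j₂ × toℕ j₂ ∸ toℕ j₁ ℕ.≤ 2

Transient : ∀ {m} → SetPartition m → Fin m → Set
Transient π j = ∃[ i ] ∃[ k ] Arc π i j × Arc π j k

isBlock? : ∀ {m} (π : SetPartition m) → Decidable (IsBlock π)
isBlock? π B with nonempty? B
... | no  empty     = no λ b → empty (nonempty π b)
... | yes (i , i∈B) with cover π i
...   | C , (c , _) , unique =
  map′ (λ C≡B → subst (IsBlock π) C≡B c) (λ b → unique (b , i∈B)) (≡-dec _≟ᵇ_ C B)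

arc? : ∀ {m} (π : SetPartition m) i j → Dec (Arc π i j)
arc? π i j = anySubset? λ B →
  isBlock? π B ×-dec i ∈? B ×-dec j ∈? B ×-dec i <? j ×-dec
  all? λ k → ¬? (k ∈? B ×-dec i <? k ×-dec k <? j)

transient? : ∀ {m} (π : SetPartition m) → Decidable (Transient π)
transient? π j = any? λ i → any? λ k → arc? π i j ×-dec arc? π j k

arcs : ∀ {m} → SetPartition m → List (Fin m × Fin m)
arcs {m} π = filter (λ (i , j) → arc? π i j) (cartesianProduct (allFin m) (allFin m))

#arcs : ∀ {m} → SetPartition m → ℕ
#arcs π = length (arcs π)

-- i₂ ≡ j₁ + 1 forces i₁ < j₁ < i₂ < j₂, so each neighbor alignment occurs
-- as exactly one ordered pair of arcs.
#neighborAlignments : ∀ {m} → SetPartition m → ℕ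
#neighborAlignments π =
  length (filter (λ ((_ , j₁) , (i₂ , _)) → toℕ i₂ ℕ.≟ ℕ.suc (toℕ j₁))
                 (cartesianProduct (arcs π) (arcs π)))

#transients : ∀ {m} → SetPartition m → ℕ
#transients {m} π = length (filter (transient? π) (allFin m))

record PElement (m k : ℕ) : Set₁ where
  field
    partition         : SetPartition m
    isPartialMatching : IsPartialMatching partition
    arcCount          : #arcs partition ≡ k
    no2RightCrossing  : ¬ 2-RightCrossing partition
    noRightNesting    : ¬ RightNesting partition

record CTElement (n k : ℕ) : Set₁ where
  field
    partition       : SetPartition n
    arcCount        : #arcs partition ≡ k
    noRightCrossing : ¬ RightCrossing partition

𝒫 : ℕ → ℕ → Setoid (lsuc 0ℓ) 0ℓ
𝒫 m k = On.setoid (SetPartitions m) (PElement.partition {m} {k})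

𝒞𝒯 : ℕ → ℕ → Setoid (lsuc 0ℓ) 0ℓ
𝒞𝒯 n k = On.setoid (SetPartitions n) (CTElement.partition {n} {k})

{-# OPTIONS --safe #-}
module Submission where

-- In a partial matching without right nestings and 2-right crossings no two
-- consecutive vertices are closers (right ends of arcs): such a pair would be a
-- right nesting or a right crossing. Append an isolated vertex at the end and glue
-- each closer to the vertex after it: the n + k vertices, k of them closers, become
-- n vertices with the same k arcs. Conversely, in a partition of [n] each vertex
-- that closes an arc is split into a closer followed by a non-closer, and the last
-- non-closer, which opens no arc, is removed. Closers at distance two become
-- closers at distance one, so 2-right crossings correspond to right crossings,
-- and a closer directly followed by an opener becomes a transient.

open import Defs
open import Data.Empty using (⊥)
open import Data.Fin as Fin using (Fin; toℕ; fromℕ<)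
open import Data.Fin.Properties using (any?; toℕ-injective; toℕ-fromℕ<; toℕ<n; injective⇒≤)
open import Data.Fin.Subset using (Subset; _∈_; ∣_∣; ⁅_⁆; _∪_; _-_; inside; outside)
open import Data.Fin.Subset.Properties
  using (_∈?_; ⊆-antisym; p⊆q⇒∣p∣≤∣q∣; ∣⁅x⁆∣≡1; x∈⁅x⁆; x∈p∪q⁺; x∈p⇒∣p-x∣<∣p∣; x∈p∧x≢y⇒x∈p-y)
open import Data.List using (List; length; filter; downFrom; lookup; allFin; cartesianProduct)
open import Data.List.Membership.Propositional using () renaming (_∈_ to _∈ᴸ_)
open import Data.List.Membership.Propositional.Properties
  using (∈-filter⁺; ∈-filter⁻; ∈-allFin; ∈-cartesianProduct⁺; ∈-cartesianProduct⁻; ∈-downFrom⁺; ∈-downFrom⁻; ∈-lookup)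
open import Data.List.Properties using (filter-accept; filter-reject)
open import Data.List.Relation.Unary.All as All using ()
open import Data.List.Relation.Unary.AllPairs using (_∷_)
open import Data.List.Relation.Unary.Any using (index)
open import Data.List.Relation.Unary.Any.Properties using (lookup-index)
open import Data.List.Relation.Unary.Unique.Propositional using (Unique)
open import Data.List.Relation.Unary.Unique.Propositional.Properties using (filter⁺; cartesianProduct⁺; allFin⁺; downFrom⁺)
open import Data.Nat using (ℕ; zero; suc; _+_; _∸_; _≤_; _<_; z≤n; s≤s; s≤s⁻¹; _≟_)
open import Data.Nat.Induction using (<-wellFounded)
open import Data.Nat.Properties
open import Data.Product using (Σ-syntax; ∃-syntax; _×_; _,_; proj₁; proj₂)
open import Data.Sum using (inj₁; inj₂)
open import Data.Vec using ([]; _∷_; tabulate)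
open import Data.Vec.Properties using (lookup⇒[]=; []=⇒lookup; lookup∘tabulate)
open import Function using (_∘_; id; _⇔_; mk⇔; Equivalence)
open import Function.Bundles using (Bijection)
open import Induction.WellFounded using (Acc; acc)
open import Relation.Binary using (tri<; tri≈; tri>)
open import Relation.Binary.PropositionalEquality
open import Relation.Nullary using (Dec; yes; no; ¬_; does; contradiction)
open import Relation.Nullary.Decidable using (map′; _×-dec_; dec-true)
open import Relation.Unary using (Decidable; _≐_)
open import Relation.Unary.Properties using (∁?; ≐-trans)

open Equivalence using (to; from)

private variable
  m n k : ℕ

-- Finite counting

lookup-injective : ∀ {A : Set} {xs : List A} → Unique xs →
  ∀ i j → lookup xs i ≡ lookup xs j → i ≡ j
lookup-injective (_ ∷ _)     Fin.zero    Fin.zero    _  = refl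
lookup-injective (x∉xs ∷ _)  Fin.zero    (Fin.suc j) eq = contradiction eq (All.lookup x∉xs (∈-lookup j))
lookup-injective (x∉xs ∷ _)  (Fin.suc i) Fin.zero    eq = contradiction (sym eq) (All.lookup x∉xs (∈-lookup i))
lookup-injective (_ ∷ uniq)  (Fin.suc i) (Fin.suc j) eq = cong Fin.suc (lookup-injective uniq i j eq)

-- Pigeonhole on positions: each position of `xs` is sent to the position of a related entry of
-- `ys`. A relation is used instead of a function so that the reverse inequality is the same lemma
-- for the flipped relation.
injectiveRelation⇒length≤ : ∀ {A B : Set} {xs : List A} {ys : List B} (R : A → B → Set) → Unique xs →
  (∀ {x} → x ∈ᴸ xs → ∃[ y ] y ∈ᴸ ys × R x y) →
  (∀ {x x′ y} → x ∈ᴸ xs → x′ ∈ᴸ xs → R x y → R x′ y → x ≡ x′) →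
  length xs ≤ length ys
injectiveRelation⇒length≤ {xs = xs} {ys} R uniq total injective = injective⇒≤ {f = f} f-injective
  where
  image : ∀ i → ∃[ y ] y ∈ᴸ ys × R (lookup xs i) y
  image i = total (∈-lookup i)

  f : Fin (length xs) → Fin (length ys)
  f i = index (proj₁ (proj₂ (image i)))

  f-related : ∀ i → R (lookup xs i) (lookup ys (f i))
  f-related i = subst (R _) (lookup-index (proj₁ (proj₂ (image i)))) (proj₂ (proj₂ (image i)))

  f-injective : ∀ {i j} → f i ≡ f j → i ≡ j
  f-injective {i} {j} eq = lookup-injective uniq i j
    (injective (∈-lookup i) (∈-lookup j) (f-related i)
      (subst (λ z → R _ (lookup ys z)) (sym eq) (f-related j)))

bijectiveRelation⇒length≡ : ∀ {A B : Set} {xs : List A} {ys : List B} (R : A → B → Set) →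
  Unique xs → Unique ys →
  (∀ {x} → x ∈ᴸ xs → ∃[ y ] y ∈ᴸ ys × R x y) →
  (∀ {y} → y ∈ᴸ ys → ∃[ x ] x ∈ᴸ xs × R x y) →
  (∀ {x x′ y} → x ∈ᴸ xs → x′ ∈ᴸ xs → R x y → R x′ y → x ≡ x′) →
  (∀ {x y y′} → y ∈ᴸ ys → y′ ∈ᴸ ys → R x y → R x y′ → y ≡ y′) →
  length xs ≡ length ys
bijectiveRelation⇒length≡ R uniqueˣ uniqueʸ totalˣ totalʸ injective functional =
  ≤-antisym (injectiveRelation⇒length≤ R uniqueˣ totalˣ injective)
            (injectiveRelation⇒length≤ (λ y x → R x y) uniqueʸ totalʸ functional)

-- Opaque, because unfolding a count evaluates the decision procedures for arcs.
opaque

  count : {P : ℕ → Set} → Decidable P → ℕ → ℕ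
  count P? p = length (filter P? (downFrom p))

module _ {P : ℕ → Set} (P? : Decidable P) where

  opaque
    unfolding count

    count-zero : count P? 0 ≡ 0
    count-zero = refl

    count-accept : ∀ {p} → P p → count P? (suc p) ≡ suc (count P? p)
    count-accept Pp = cong length (filter-accept P? Pp)

    count-reject : ∀ {p} → ¬ P p → count P? (suc p) ≡ count P? p
    count-reject ¬Pp = cong length (filter-reject P? ¬Pp)

    count-≤-suc : ∀ p → count P? p ≤ count P? (suc p)
    count-≤-suc p with P? p
    ... | yes _ = n≤1+n _
    ... | no  _ = ≤-refl

    count-mono-≤ : ∀ {p q} → p ≤ q → count P? p ≤ count P? q
    count-mono-≤ {p} {q} p≤q with m≤n⇒m<n∨m≡n p≤q
    count-mono-≤ {p} {suc q} _ | inj₁ p<1+q = ≤-trans (count-mono-≤ (s≤s⁻¹ p<1+q)) (count-≤-suc q)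
    ... | inj₂ refl = ≤-refl

    count-mono-< : ∀ {p q} → P p → p < q → count P? p < count P? q
    count-mono-< Pp p<q = subst (_≤ _) (count-accept Pp) (count-mono-≤ p<q)

    count-∁ : ∀ p → count (∁? P?) p + count P? p ≡ p
    count-∁ zero = refl
    count-∁ (suc p) with P? p
    ... | yes _ = trans (+-suc _ _) (cong suc (count-∁ p))
    ... | no  _ = cong suc (count-∁ p)

opaque
  unfolding count

  count-cong : {P Q : ℕ → Set} (P? : Decidable P) (Q? : Decidable Q) →
    ∀ p → (∀ {i} → i < p → P i ⇔ Q i) → count P? p ≡ count Q? p
  count-cong P? Q? zero    _   = refl
  count-cong P? Q? (suc p) P⇔Q with P? p | count-cong P? Q? p (P⇔Q ∘ m<n⇒m<1+n)
  ... | yes Pp | eq = trans (cong suc eq) (sym (count-accept Q? (to (P⇔Q ≤-refl) Pp)))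
  ... | no ¬Pp | eq = trans eq (sym (count-reject Q? (¬Pp ∘ from (P⇔Q ≤-refl))))

  -- Injectivity is asked on `P` only: the map `slot` used later identifies a closer with its
  -- successor, yet separates closers from each other.
  count-bijection : {P Q : ℕ → Set} (P? : Decidable P) (Q? : Decidable Q) (f : ℕ → ℕ) →
    (∀ {p} → p < m → P p → f p < n × Q (f p)) →
    (∀ {q} → q < n → Q q → ∃[ p ] p < m × P p × f p ≡ q) →
    (∀ {p p′} → P p → P p′ → f p ≡ f p′ → p ≡ p′) →
    count P? m ≡ count Q? n
  count-bijection {m} {n} {P} {Q} P? Q? f total surjective injective =
    bijectiveRelation⇒length≡ (λ p q → f p ≡ q) (filter⁺ P? (downFrom⁺ m)) (filter⁺ Q? (downFrom⁺ n))
      totalˣ totalʸ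
      (λ p∈ p′∈ eq eq′ → injective (proj₂ (∈⁻ P? m p∈)) (proj₂ (∈⁻ P? m p′∈)) (trans eq (sym eq′)))
      (λ _ _ eq eq′ → trans (sym eq) eq′)
    where
    ∈⁻ : {P : ℕ → Set} (P? : Decidable P) → ∀ l {p} → p ∈ᴸ filter P? (downFrom l) → p < l × P p
    ∈⁻ P? l p∈ with p∈ , Pp ← ∈-filter⁻ P? {xs = downFrom l} p∈ = ∈-downFrom⁻ p∈ , Pp

    totalˣ : ∀ {p} → p ∈ᴸ filter P? (downFrom m) → ∃[ q ] q ∈ᴸ filter Q? (downFrom n) × f p ≡ q
    totalˣ p∈ with p<m , Pp ← ∈⁻ P? m p∈ with q<n , Qq ← total p<m Pp =
      _ , ∈-filter⁺ Q? (∈-downFrom⁺ q<n) Qq , refl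

    totalʸ : ∀ {q} → q ∈ᴸ filter Q? (downFrom n) → ∃[ p ] p ∈ᴸ filter P? (downFrom m) × f p ≡ q
    totalʸ q∈ with q<n , Qq ← ∈⁻ Q? n q∈ with p , p<m , Pp , eq ← surjective q<n Qq =
      p , ∈-filter⁺ P? (∈-downFrom⁺ p<m) Pp , eq

-- Set partitions and their arcs

∣p∪q∣≤∣p∣+∣q∣ : (p q : Subset m) → ∣ p ∪ q ∣ ≤ ∣ p ∣ + ∣ q ∣
∣p∪q∣≤∣p∣+∣q∣ []            []            = z≤n
∣p∪q∣≤∣p∣+∣q∣ (outside ∷ p) (outside ∷ q) = ∣p∪q∣≤∣p∣+∣q∣ p q
∣p∪q∣≤∣p∣+∣q∣ (outside ∷ p) (inside ∷ q)  =
  ≤-trans (s≤s (∣p∪q∣≤∣p∣+∣q∣ p q)) (≤-reflexive (sym (+-suc _ _)))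
∣p∪q∣≤∣p∣+∣q∣ (inside ∷ p)  (outside ∷ q) = s≤s (∣p∪q∣≤∣p∣+∣q∣ p q)
∣p∪q∣≤∣p∣+∣q∣ (inside ∷ p)  (inside ∷ q)  =
  s≤s (≤-trans (∣p∪q∣≤∣p∣+∣q∣ p q) (+-monoʳ-≤ _ (n≤1+n _)))

-- The bound is a natural number so that it can be a vertex, giving the predecessor of that vertex
-- in `B`, or `m` itself, giving the maximum of `B`.
greatest-∈ : (B : Subset m) (x : ℕ) {i : Fin m} → i ∈ B → toℕ i < x →
  ∃[ p ] p ∈ B × toℕ p < x × (∀ {l} → l ∈ B → toℕ l < x → toℕ l ≤ toℕ p)
greatest-∈ B (suc x) i∈B (s≤s i≤x) with any? (λ p → p ∈? B ×-dec toℕ p ≟ x)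
... | yes (p , p∈B , refl) = p , p∈B , ≤-refl , λ _ → s≤s⁻¹
... | no none with greatest-∈ B x i∈B (≤∧≢⇒< i≤x λ eq → none (_ , i∈B , eq))
... | p , p∈B , p<x , greatest = p , p∈B , m<n⇒m<1+n p<x ,
  λ l∈B l<1+x → greatest l∈B (≤∧≢⇒< (s≤s⁻¹ l<1+x) λ eq → none (_ , l∈B , eq))

block-unique : (π : SetPartition m) → ∀ {B C i} →
  IsBlock π B → IsBlock π C → i ∈ B → i ∈ C → B ≡ C
block-unique π {i = i} b c i∈B i∈C with _ , _ , unique ← cover π i =
  trans (sym (unique (b , i∈B))) (unique (c , i∈C))

predecessor : (π : SetPartition m) → ∀ {B i j} → IsBlock π B → i ∈ B → j ∈ B → i Fin.< j →
  ∃[ p ] Arc π p j × p ∈ B × (∀ {l} → l ∈ B → l Fin.< j → l Fin.≤ p)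
predecessor π {B} {j = j} b i∈B j∈B i<j with greatest-∈ B (toℕ j) i∈B i<j
... | p , p∈B , p<j , greatest =
  p , (B , b , p∈B , j∈B , p<j , λ l (l∈B , p<l , l<j) → <⇒≱ p<l (greatest l∈B l<j)) , p∈B , greatest

-- Induction on the larger vertex `j`: the arc into `j` from its predecessor `p` is also an arc of
-- `π′`, so `p` and `j` share a block there, and the induction hypothesis links `i` to `p`. Both
-- directions are kept because `block-⊆` may start from the smaller or the larger vertex.
sameBlock-mono : (π π′ : SetPartition m) → (∀ {i j} → Arc π i j → Arc π′ i j) →
  ∀ {B C i j} → IsBlock π B → i ∈ B → j ∈ B → i Fin.< j → Acc _<_ (toℕ j) →
  IsBlock π′ C → (i ∈ C ⇔ j ∈ C)
sameBlock-mono π π′ arc⊆ {B} {C} {i} {j} b i∈B j∈B i<j (acc rec) c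
  with predecessor π b i∈B j∈B i<j
... | p , arc , p∈B , greatest with arc⊆ arc
... | D , d , p∈D , j∈D , p<j , _ with m≤n⇒m<n∨m≡n (greatest i∈B i<j)
...   | inj₁ i<p = let ih = sameBlock-mono π π′ arc⊆ b i∈B p∈B i<p (rec p<j) c in
  mk⇔ (λ i∈C → subst (j ∈_) (block-unique π′ d c p∈D (to ih i∈C)) j∈D)
      (λ j∈C → from ih (subst (p ∈_) (block-unique π′ d c j∈D j∈C) p∈D))
...   | inj₂ i≡p with refl ← toℕ-injective i≡p =
  mk⇔ (λ i∈C → subst (j ∈_) (block-unique π′ d c p∈D i∈C) j∈D)
      (λ j∈C → subst (i ∈_) (block-unique π′ d c j∈D j∈C) p∈D)

block-⊆ : (π π′ : SetPartition m) → (∀ {i j} → Arc π i j → Arc π′ i j) →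
  ∀ {B C i j} → IsBlock π B → IsBlock π′ C → i ∈ B → i ∈ C → j ∈ B → j ∈ C
block-⊆ π π′ arc⊆ {i = i} {j} b c i∈B i∈C j∈B with <-cmp (toℕ i) (toℕ j)
... | tri< i<j _ _ = to (sameBlock-mono π π′ arc⊆ b i∈B j∈B i<j (<-wellFounded _) c) i∈C
... | tri≈ _ i≡j _ = subst (_∈ _) (toℕ-injective i≡j) i∈C
... | tri> _ _ j<i = from (sameBlock-mono π π′ arc⊆ b j∈B i∈B j<i (<-wellFounded _) c) i∈C

isBlock-mono : (π π′ : SetPartition m) → (∀ {i j} → Arc π i j ⇔ Arc π′ i j) →
  ∀ {B} → IsBlock π B → IsBlock π′ B
isBlock-mono π π′ arc⇔ {B} b with nonempty π b
... | i , i∈B with cover π′ i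
... | C , (c , i∈C) , _ = subst (IsBlock π′) (sym B≡C) c
  where
  B≡C : B ≡ C
  B≡C = ⊆-antisym (block-⊆ π π′ (to arc⇔) b c i∈B i∈C) (block-⊆ π′ π (from arc⇔) c b i∈C i∈B)

-- Two arcs into `j` belong to the same block, so the larger of two distinct sources would lie in
-- the gap of the other arc. Target uniqueness below is the mirror image.
Arc-sourceUnique : (π : SetPartition m) → ∀ {i i′ j} → Arc π i j → Arc π i′ j → i ≡ i′
Arc-sourceUnique π {i} {i′} (B , b , i∈B , j∈B , i<j , gap) (C , c , i′∈C , j∈C , i′<j , gap′)
  with refl ← block-unique π b c j∈B j∈C | <-cmp (toℕ i) (toℕ i′)
... | tri< i<i′ _ _ = contradiction (i′∈C , i<i′ , i′<j) (gap i′)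
... | tri≈ _ i≡i′ _ = toℕ-injective i≡i′
... | tri> _ _ i′<i = contradiction (i∈B , i′<i , i<j) (gap′ i)

Arc-targetUnique : (π : SetPartition m) → ∀ {i j j′} → Arc π i j → Arc π i j′ → j ≡ j′
Arc-targetUnique π {j = j} {j′} (B , b , i∈B , j∈B , i<j , gap) (C , c , i∈C , j′∈C , i<j′ , gap′)
  with refl ← block-unique π b c i∈B i∈C | <-cmp (toℕ j) (toℕ j′)
... | tri< j<j′ _ _ = contradiction (j∈B , i<j , j<j′) (gap′ j)
... | tri≈ _ j≡j′ _ = toℕ-injective j≡j′
... | tri> _ _ j′<j = contradiction (j′∈C , i<j′ , j′<j) (gap j′)

-- Two arcs meeting at `j` put three distinct vertices into one block; removing them one after
-- another shows that the block has more than two elements.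
partialMatching⇒noTransient : (π : SetPartition m) → IsPartialMatching π →
  ∀ {i j l} → Arc π i j → ¬ Arc π j l
partialMatching⇒noTransient π matching {i} {j} {l}
  (B , b , i∈B , j∈B , i<j , _) (C , c , j∈C , l∈C , j<l , _)
  with refl ← block-unique π b c j∈B j∈C = <⇒≱ 2<∣B∣ (matching b)
  where
  j∈B-i : j ∈ B - i
  j∈B-i = x∈p∧x≢y⇒x∈p-y j∈B (λ { refl → <-irrefl refl i<j })

  l∈B-i-j : l ∈ (B - i) - j
  l∈B-i-j = x∈p∧x≢y⇒x∈p-y (x∈p∧x≢y⇒x∈p-y l∈C (λ { refl → <-asym i<j j<l })) (λ { refl → <-irrefl refl j<l })

  2<∣B∣ : 2 < ∣ B ∣
  2<∣B∣ = ≤-<-trans (≤-<-trans (≤-<-trans z≤n (x∈p⇒∣p-x∣<∣p∣ l∈B-i-j)) (x∈p⇒∣p-x∣<∣p∣ j∈B-i)) (x∈p⇒∣p-x∣<∣p∣ i∈B)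

-- Let `j` be the maximum of the block and `p` its predecessor. Any vertex below `p` would yield an
-- arc into `p`, making `p` a transient, so the block has no elements besides `p` and `j`.
noTransient⇒partialMatching : (π : SetPartition m) →
  (∀ {i j l} → Arc π i j → ¬ Arc π j l) → IsPartialMatching π
noTransient⇒partialMatching π noTransient {B} b with nonempty π b
... | i , i∈B with greatest-∈ B _ i∈B (toℕ<n i)
... | j , j∈B , _ , j-greatest with any? (λ l → l ∈? B ×-dec l Fin.<? j)
...   | no none = ≤-trans (p⊆q⇒∣p∣≤∣q∣ B⊆⁅j⁆) (≤-trans (≤-reflexive (∣⁅x⁆∣≡1 j)) (n≤1+n 1))
  where
  B⊆⁅j⁆ : ∀ {l} → l ∈ B → l ∈ ⁅ j ⁆
  B⊆⁅j⁆ {l} l∈B with m≤n⇒m<n∨m≡n (j-greatest l∈B (toℕ<n l))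
  ... | inj₁ l<j = contradiction (l , l∈B , l<j) none
  ... | inj₂ l≡j with refl ← toℕ-injective l≡j = x∈⁅x⁆ j
...   | yes (_ , l∈B , l<j) with predecessor π b l∈B j∈B l<j
...     | p , arc , p∈B , p-greatest = ≤-trans (p⊆q⇒∣p∣≤∣q∣ B⊆⁅p,j⁆)
  (≤-trans (∣p∪q∣≤∣p∣+∣q∣ ⁅ p ⁆ ⁅ j ⁆) (≤-reflexive (cong₂ _+_ (∣⁅x⁆∣≡1 p) (∣⁅x⁆∣≡1 j))))
  where
  B⊆⁅p,j⁆ : ∀ {l} → l ∈ B → l ∈ ⁅ p ⁆ ∪ ⁅ j ⁆
  B⊆⁅p,j⁆ {l} l∈B with m≤n⇒m<n∨m≡n (j-greatest l∈B (toℕ<n l))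
  ... | inj₂ l≡j with refl ← toℕ-injective l≡j = x∈p∪q⁺ (inj₂ (x∈⁅x⁆ j))
  ... | inj₁ l<j with m≤n⇒m<n∨m≡n (p-greatest l∈B l<j)
  ...   | inj₂ l≡p with refl ← toℕ-injective l≡p = x∈p∪q⁺ (inj₁ (x∈⁅x⁆ p))
  ...   | inj₁ l<p = contradiction arc (noTransient (proj₁ (proj₂ (predecessor π b l∈B p∈B l<p))))

-- Arc diagrams

-- Vertices are plain naturals, so that positions can be shifted and counted without bounds in their
-- types; as arcs increase, bounding targets bounds sources too. The uniqueness fields make the arcs
-- form disjoint increasing paths, as in the linear representation of a set partition.
record ArcDiagram (m : ℕ) : Set₁ where
  infix 4 _⌢_
  field
    _⌢_           : ℕ → ℕ → Set
    closer?       : Decidable (λ j → ∃[ i ] i ⌢ j)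
    increasing    : ∀ {i j} → i ⌢ j → i < j
    bounded       : ∀ {i j} → i ⌢ j → j < m
    source-unique : ∀ {i i′ j} → i ⌢ j → i′ ⌢ j → i ≡ i′
    target-unique : ∀ {i j j′} → i ⌢ j → i ⌢ j′ → j ≡ j′

  Closer : ℕ → Set
  Closer j = ∃[ i ] i ⌢ j

  #closers : ℕ
  #closers = count closer? m

open ArcDiagram using (closer?; increasing; bounded; source-unique; target-unique; Closer; #closers)

infix 4 _≋_
_≋_ : ArcDiagram m → ArcDiagram m → Set
A ≋ B = ∀ {i j} → ArcDiagram._⌢_ A i j ⇔ ArcDiagram._⌢_ B i j

≋-sym : {A B : ArcDiagram m} → A ≋ B → B ≋ A
≋-sym eq = mk⇔ (from eq) (to eq)

≋-trans : {A B C : ArcDiagram m} → A ≋ B → B ≋ C → A ≋ C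
≋-trans eq eq′ = mk⇔ (to eq′ ∘ to eq) (from eq ∘ from eq′)

diagram : SetPartition m → ArcDiagram m
diagram {m} π = record
  { _⌢_           = _⌢_
  ; closer?       = λ j → map′ (λ (i , j′ , arc , eq) → toℕ i , i , j′ , arc , refl , eq)
                               (λ (_ , i , j′ , arc , _ , eq) → i , j′ , arc , eq)
                               (any? λ i → any? λ j′ → arc? π i j′ ×-dec toℕ j′ ≟ j)
  ; increasing    = λ { (_ , _ , (_ , _ , _ , _ , i<j , _) , refl , refl) → i<j }
  ; bounded       = λ { (_ , j , _ , _ , refl) → toℕ<n j }
  ; source-unique = λ { (_ , _ , arc , refl , refl) (_ , _ , arc′ , refl , eq) →
                        cong toℕ (Arc-sourceUnique π arc (subst (Arc π _) (toℕ-injective eq) arc′)) }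
  ; target-unique = λ { (_ , _ , arc , refl , refl) (_ , _ , arc′ , eq , refl) →
                        cong toℕ (Arc-targetUnique π arc (subst (λ i → Arc π i _) (toℕ-injective eq) arc′)) }
  }
  where
  _⌢_ : ℕ → ℕ → Set
  i ⌢ j = ∃[ i′ ] ∃[ j′ ] Arc π i′ j′ × toℕ i′ ≡ i × toℕ j′ ≡ j

Represents : ArcDiagram m → SetPartition m → Set
Represents A π = A ≋ diagram π

diagram-represents : (π : SetPartition m) → Represents (diagram π) π
diagram-represents π = mk⇔ id id

diagram-arc : (π : SetPartition m) → ∀ {i j} →
  ArcDiagram._⌢_ (diagram π) (toℕ i) (toℕ j) → Arc π i j
diagram-arc π (_ , _ , arc , eq , eq′) = subst₂ (Arc π) (toℕ-injective eq) (toℕ-injective eq′) arc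

diagram-injective : (π π′ : SetPartition m) → diagram π ≋ diagram π′ → IsBlock π ≐ IsBlock π′
diagram-injective π π′ eq =
  isBlock-mono π π′ (mk⇔ arc⊆ arc⊇) , isBlock-mono π′ π (mk⇔ arc⊇ arc⊆)
  where
  arc⊆ : ∀ {i j} → Arc π i j → Arc π′ i j
  arc⊆ arc = diagram-arc π′ (to eq (_ , _ , arc , refl , refl))

  arc⊇ : ∀ {i j} → Arc π′ i j → Arc π i j
  arc⊇ arc = diagram-arc π (from eq (_ , _ , arc , refl , refl))

diagram-cong : (π π′ : SetPartition m) → IsBlock π ≐ IsBlock π′ → diagram π ≋ diagram π′
diagram-cong π π′ (⊆ , ⊇) =
  mk⇔ (λ (i , j , (B , b , arc) , eqs) → i , j , (B , ⊆ b , arc) , eqs)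
      (λ (i , j , (B , b , arc) , eqs) → i , j , (B , ⊇ b , arc) , eqs)

-- From arc diagrams back to set partitions

module _ (A : ArcDiagram m) where
  open ArcDiagram A using (_⌢_)

  -- The first vertex of a path of arcs serves as the name of its block. The derivation records the
  -- path itself, which gives the later arguments something to induct on.
  data Root (r : ℕ) : ℕ → Set where
    here  : ¬ Closer A r → Root r r
    along : ∀ {i j} → i ⌢ j → Root r i → Root r j

  Root-≤ : ∀ {r j} → Root r j → r ≤ j
  Root-≤ (here _)        = ≤-refl
  Root-≤ (along arc rt) = ≤-trans (Root-≤ rt) (<⇒≤ (increasing A arc))

  Root-unique : ∀ {r s j} → Root r j → Root s j → r ≡ s
  Root-unique (here _)       (here _)         = refl
  Root-unique (here ¬closer) (along arc _)    = contradiction (_ , arc) ¬closer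
  Root-unique (along arc _)  (here ¬closer)   = contradiction (_ , arc) ¬closer
  Root-unique (along arc rt) (along arc′ rt′) with refl ← source-unique A arc arc′ = Root-unique rt rt′

  root-acc : ∀ j → Acc _<_ j → ∃[ r ] Root r j
  root-acc j (acc rec) with closer? A j
  ... | no ¬closer    = j , here ¬closer
  ... | yes (i , arc) with root-acc i (rec (increasing A arc))
  ...   | r , rt = r , along arc rt

  root : ℕ → ℕ
  root j = proj₁ (root-acc j (<-wellFounded j))

  root-Root : ∀ j → Root (root j) j
  root-Root j = proj₂ (root-acc j (<-wellFounded j))

  root-⌢ : ∀ {i j} → i ⌢ j → root i ≡ root j
  root-⌢ arc = Root-unique (along arc (root-Root _)) (root-Root _)

  -- Compare `i` with the source `i′` of the arc into `l`. If `i < i′`, the arc `i ⌢ j` also jumps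
  -- over `i′`; if they are equal, target uniqueness forces `l` to be `j`; if `i′ < i`, the arc
  -- `i′ ⌢ l` jumps over `i`, the same situation with the roles exchanged. Each recursive call drops
  -- the last arc from the path to `l`.
  ⌢-gap : ∀ {r i j l} → i ⌢ j → i < l → l < j → Root r i → Root r l → ⊥
  ⌢-gap arc i<l l<j ri (here _) = <⇒≱ i<l (Root-≤ ri)
  ⌢-gap {i = i} arc i<l l<j ri (along {i′} arc′ ri′) with <-cmp i i′
  ... | tri< i<i′ _ _ = ⌢-gap arc i<i′ (<-trans (increasing A arc′) l<j) ri ri′
  ... | tri≈ _ refl _ = <-irrefl (target-unique A arc′ arc) l<j
  ... | tri> _ _ i′<i = ⌢-gap arc′ i′<i i<l ri′ ri

  rootBlock : ℕ → Subset m
  rootBlock r = tabulate (λ x → does (root (toℕ x) ≟ r))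

  ∈-rootBlock⁺ : ∀ {r x} → root (toℕ x) ≡ r → x ∈ rootBlock r
  ∈-rootBlock⁺ {r} {x} eq = lookup⇒[]= x _ (trans (lookup∘tabulate _ x) (dec-true (_ ≟ _) eq))

  ∈-rootBlock⁻ : ∀ {r x} → x ∈ rootBlock r → root (toℕ x) ≡ r
  ∈-rootBlock⁻ {r} {x} x∈ =
    does⁻ (root (toℕ x) ≟ r) (trans (sym (lookup∘tabulate _ x)) ([]=⇒lookup x∈))
    where
    does⁻ : {P : Set} (P? : Dec P) → does P? ≡ inside → P
    does⁻ (yes p) _ = p

  opaque

    toPartition : SetPartition m
    toPartition = record
      { IsBlock  = λ B → ∃[ i ] B ≡ rootBlock (root (toℕ i))
      ; nonempty = λ (i , B≡) → i , subst (i ∈_) (sym B≡) (∈-rootBlock⁺ refl)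
      ; cover    = λ i → rootBlock (root (toℕ i)) , ((i , refl) , ∈-rootBlock⁺ refl) ,
                         λ ((_ , B≡) , i∈B) → trans (cong rootBlock (∈-rootBlock⁻ (subst (i ∈_) B≡ i∈B))) (sym B≡)
      }

    toPartition-arc⁺ : ∀ {i j} → toℕ i ⌢ toℕ j → Arc toPartition i j
    toPartition-arc⁺ {i} {j} arc =
      rootBlock (root (toℕ i)) , (i , refl) , ∈-rootBlock⁺ refl , ∈-rootBlock⁺ (sym (root-⌢ arc)) , increasing A arc ,
      λ l (l∈B , i<l , l<j) → ⌢-gap arc i<l l<j (root-Root _) (subst (λ r → Root r _) (∈-rootBlock⁻ l∈B) (root-Root _))

    -- If no arc of the diagram enters `j`, then `j` is the root of its block, hence at most `i`.
    -- Otherwise let `p` be the source of the arc into `j`: `p < i` is excluded by `⌢-gap`, and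
    -- `i < p` would place the block element `p` in the gap between `i` and `j`.
    toPartition-arc⁻ : ∀ {i j} → Arc toPartition i j → toℕ i ⌢ toℕ j
    toPartition-arc⁻ {i} {j} (B , (x , refl) , i∈B , j∈B , i<j , gap)
      with root (toℕ x) | ∈-rootBlock⁻ i∈B | root (toℕ j) | root-Root (toℕ j) | ∈-rootBlock⁻ j∈B
    ... | _ | refl | _ | here _ | eq = contradiction (Root-≤ (root-Root (toℕ i))) (<⇒≱ (subst (toℕ i <_) eq i<j))
    ... | _ | refl | _ | along {p} arc rt | refl with <-cmp (toℕ i) p
    ...   | tri≈ _ i≡p _ = subst (_⌢ toℕ j) (sym i≡p) arc
    ...   | tri> _ _ p<i = contradiction (root-Root (toℕ i)) (⌢-gap arc p<i i<j rt)
    ...   | tri< i<p _ _ = contradiction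
      (∈-rootBlock⁺ (trans (cong root p′≡p) (Root-unique (root-Root p) rt)) , subst (toℕ i <_) (sym p′≡p) i<p , subst (_< toℕ j) (sym p′≡p) (increasing A arc))
      (gap (fromℕ< p<m))
      where
      p<m : p < m
      p<m = <-trans (increasing A arc) (bounded A arc)
      p′≡p : toℕ (fromℕ< p<m) ≡ p
      p′≡p = toℕ-fromℕ< p<m

  toPartition-represents : Represents A toPartition
  toPartition-represents {i} {j} =
    mk⇔ (λ arc → fromℕ< (<-trans (increasing A arc) (bounded A arc)) , fromℕ< (bounded A arc) ,
                 toPartition-arc⁺ (subst₂ _⌢_ (sym (toℕ-fromℕ< _)) (sym (toℕ-fromℕ< _)) arc) ,
                 toℕ-fromℕ< _ , toℕ-fromℕ< _)
        (λ { (_ , _ , arc , refl , refl) → toPartition-arc⁻ arc })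

toPartition-cong : (A B : ArcDiagram m) → A ≋ B → IsBlock (toPartition A) ≐ IsBlock (toPartition B)
toPartition-cong A B A≋B = diagram-injective (toPartition A) (toPartition B)
  (mk⇔ (to (toPartition-represents B) ∘ to A≋B ∘ from (toPartition-represents A))
       (to (toPartition-represents A) ∘ from A≋B ∘ from (toPartition-represents B)))

toPartition-injective : (A B : ArcDiagram m) → IsBlock (toPartition A) ≐ IsBlock (toPartition B) → A ≋ B
toPartition-injective A B π≈π′ =
  mk⇔ (from (toPartition-represents B) ∘ to eq ∘ to (toPartition-represents A))
      (from (toPartition-represents A) ∘ from eq ∘ to (toPartition-represents B))
  where
  eq : diagram (toPartition A) ≋ diagram (toPartition B)
  eq = diagram-cong (toPartition A) (toPartition B) π≈π′

-- Counting arcs, neighbor alignments and transients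

∈-arcs⁺ : (π : SetPartition m) → ∀ {i j} → Arc π i j → (i , j) ∈ᴸ arcs π
∈-arcs⁺ π arc = ∈-filter⁺ _ (∈-cartesianProduct⁺ (∈-allFin _) (∈-allFin _)) arc

∈-arcs⁻ : (π : SetPartition m) → ∀ {i j} → (i , j) ∈ᴸ arcs π → Arc π i j
∈-arcs⁻ {m} π ij∈ = proj₂ (∈-filter⁻ (λ (i , j) → arc? π i j) {xs = cartesianProduct (allFin m) (allFin m)} ij∈)

arcs-unique : (π : SetPartition m) → Unique (arcs π)
arcs-unique {m} π = filter⁺ _ (cartesianProduct⁺ (allFin⁺ m) (allFin⁺ m))

-- A neighbor alignment is determined by `j₁` alone: it fixes `i₂` as its successor, and source and
-- target uniqueness then fix `i₁` and `j₂`. Hence it suffices that `f` acts on first targets.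
alignmentBijection : (π : SetPartition m) (π′ : SetPartition n) (f : ℕ → ℕ) →
  (∀ {i₁ j₁ i₂ j₂} → Arc π i₁ j₁ → Arc π i₂ j₂ → toℕ i₂ ≡ suc (toℕ j₁) →
    ∃[ w ] Transient π′ w × f (toℕ j₁) ≡ toℕ w) →
  (∀ {w} → Transient π′ w → ∃[ i₁ ] ∃[ j₁ ] ∃[ i₂ ] ∃[ j₂ ]
    Arc π i₁ j₁ × Arc π i₂ j₂ × toℕ i₂ ≡ suc (toℕ j₁) × f (toℕ j₁) ≡ toℕ w) →
  (∀ {i i′ j j′} → Arc π i j → Arc π i′ j′ → f (toℕ j) ≡ f (toℕ j′) → j ≡ j′) →
  #neighborAlignments π ≡ #transients π′
alignmentBijection {m} {n} π π′ f total surjective injective =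
  bijectiveRelation⇒length≡ (λ a w → f (toℕ (proj₂ (proj₁ a))) ≡ toℕ w)
    (filter⁺ neighbor? (cartesianProduct⁺ (arcs-unique π) (arcs-unique π)))
    (filter⁺ (transient? π′) (allFin⁺ n))
    (λ a∈ → let arc₁ , arc₂ , neighbor = alignment⁻ a∈
                w , transient , eq = total arc₁ arc₂ neighbor
            in w , ∈-filter⁺ (transient? π′) (∈-allFin w) transient , eq)
    (λ w∈ → let i₁ , j₁ , i₂ , j₂ , arc₁ , arc₂ , neighbor , eq =
                  surjective (proj₂ (∈-filter⁻ (transient? π′) {xs = allFin n} w∈))
            in ((i₁ , j₁) , (i₂ , j₂)) , alignment⁺ (arc₁ , arc₂ , neighbor) , eq)
    (λ a∈ a′∈ eq eq′ → alignment-unique (alignment⁻ a∈) (alignment⁻ a′∈) (trans eq (sym eq′)))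
    (λ _ _ eq eq′ → toℕ-injective (trans (sym eq) eq′))
  where
  ArcPair : Set
  ArcPair = (Fin m × Fin m) × (Fin m × Fin m)

  Neighbor : ArcPair → Set
  Neighbor ((_ , j₁) , (i₂ , _)) = toℕ i₂ ≡ suc (toℕ j₁)

  neighbor? : Decidable Neighbor
  neighbor? ((_ , j₁) , (i₂ , _)) = toℕ i₂ ≟ suc (toℕ j₁)

  Alignment : ArcPair → Set
  Alignment a@((i₁ , j₁) , (i₂ , j₂)) = Arc π i₁ j₁ × Arc π i₂ j₂ × Neighbor a

  alignment⁻ : ∀ {a} → a ∈ᴸ filter neighbor? (cartesianProduct (arcs π) (arcs π)) → Alignment a
  alignment⁻ a∈ =
    let a∈ , neighbor = ∈-filter⁻ neighbor? {xs = cartesianProduct (arcs π) (arcs π)} a∈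
        arc₁∈ , arc₂∈ = ∈-cartesianProduct⁻ (arcs π) (arcs π) a∈
    in ∈-arcs⁻ π arc₁∈ , ∈-arcs⁻ π arc₂∈ , neighbor

  alignment⁺ : ∀ {a} → Alignment a → a ∈ᴸ filter neighbor? (cartesianProduct (arcs π) (arcs π))
  alignment⁺ (arc₁ , arc₂ , neighbor) =
    ∈-filter⁺ neighbor? (∈-cartesianProduct⁺ (∈-arcs⁺ π arc₁) (∈-arcs⁺ π arc₂)) neighbor

  alignment-unique : ∀ {a a′} → Alignment a → Alignment a′ →
    f (toℕ (proj₂ (proj₁ a))) ≡ f (toℕ (proj₂ (proj₁ a′))) → a ≡ a′
  alignment-unique (arc₁ , arc₂ , eq) (arc₁′ , arc₂′ , eq′) f≡
    with refl ← injective arc₁ arc₁′ f≡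
    with refl ← toℕ-injective (trans eq (sym eq′))
    with refl ← Arc-sourceUnique π arc₁ arc₁′ | refl ← Arc-targetUnique π arc₂ arc₂′ = refl

opaque
  unfolding count

  -- By source uniqueness an arc is the same as its target, so arcs can be counted as closers.
  #arcs≡#closers : (A : ArcDiagram m) (π : SetPartition m) → Represents A π → #arcs π ≡ #closers A
  #arcs≡#closers {m} A π rep =
    bijectiveRelation⇒length≡ (λ (_ , j) q → toℕ j ≡ q) (arcs-unique π) (filter⁺ (closer? A) (downFrom⁺ m))
      (λ { {i , j} ij∈ → toℕ j , ∈-filter⁺ (closer? A) (∈-downFrom⁺ (toℕ<n j))
             (toℕ i , from rep (i , j , ∈-arcs⁻ π ij∈ , refl , refl)) , refl })
      totalʸ
      (λ { {_ , j} {_ , j′} ij∈ ij′∈ eq eq′ → injective (∈-arcs⁻ π ij∈) (∈-arcs⁻ π ij′∈) (toℕ-injective (trans eq (sym eq′))) })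
      (λ _ _ eq eq′ → trans (sym eq) eq′)
    where
    totalʸ : ∀ {q} → q ∈ᴸ filter (closer? A) (downFrom m) → ∃[ ij ] ij ∈ᴸ arcs π × toℕ (proj₂ ij) ≡ q
    totalʸ q∈ with _ , _ , arc ← ∈-filter⁻ (closer? A) {xs = downFrom m} q∈ with i , j , arc′ , _ , eq ← to rep arc =
      (i , j) , ∈-arcs⁺ π arc′ , eq

    injective : ∀ {i i′ j j′} → Arc π i j → Arc π i′ j′ → j ≡ j′ → (i , j) ≡ (i′ , j′)
    injective arc arc′ refl = cong (_, _) (Arc-sourceUnique π arc arc′)

closer-cong : (A B : ArcDiagram m) → A ≋ B → ∀ {j} → Closer A j ⇔ Closer B j
closer-cong A B eq = mk⇔ (λ (i , arc) → i , to eq arc) (λ (i , arc) → i , from eq arc)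

-- Gluing each closer of a matching to the vertex that follows it

-- `noAdjacentClosers` absorbs the right nestings and the right crossings. Crossings whose closers
-- are at distance two are treated separately, when they are compared with the right crossings of
-- the glued diagram.
record SparseMatching (m k : ℕ) : Set₁ where
  field
    arcDiagram         : ArcDiagram m
    noTransient        : ∀ {i j l} → ArcDiagram._⌢_ arcDiagram i j → ¬ ArcDiagram._⌢_ arcDiagram j l
    noAdjacentClosers  : ∀ {j} → Closer arcDiagram j → ¬ Closer arcDiagram (suc j)
    closerCount        : #closers arcDiagram ≡ k

open SparseMatching using (arcDiagram)

module _ (M : SparseMatching m k) where
  open SparseMatching M hiding (arcDiagram)
  private A = arcDiagram M
  open ArcDiagram A using (_⌢_)

  -- The glued vertices are numbered by the non-closers.
  slot : ℕ → ℕ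
  slot = count (∁? (closer? A))

  source⇒nonCloser : ∀ {p q} → p ⌢ q → ¬ Closer A p
  source⇒nonCloser arc (_ , arc′) = noTransient arc′ arc

  slot-suc-closer : ∀ {q} → Closer A q → slot (suc q) ≡ slot q
  slot-suc-closer q-closer = count-reject (∁? (closer? A)) (λ ¬closer → ¬closer q-closer)

  slot-suc-nonCloser : ∀ {q} → ¬ Closer A q → slot (suc q) ≡ suc (slot q)
  slot-suc-nonCloser = count-accept (∁? (closer? A))

  slot-mono-≤ : ∀ {p q} → p ≤ q → slot p ≤ slot q
  slot-mono-≤ = count-mono-≤ (∁? (closer? A))

  slot-cancel-< : ∀ {p q} → slot p < slot q → p < q
  slot-cancel-< lt = ≰⇒> λ q≤p → <⇒≱ lt (slot-mono-≤ q≤p)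

  slot-mono-<-nonCloser : ∀ {p q} → ¬ Closer A p → p < q → slot p < slot q
  slot-mono-<-nonCloser = count-mono-< (∁? (closer? A))

  -- Some non-closer `x` satisfies `p ≤ x < q`: either `p` itself or `suc p`, which is not a closer
  -- next to the closer `p` and so differs from `q`.
  slot-mono-<-closer : ∀ {p q} → Closer A q → p < q → slot p < slot q
  slot-mono-<-closer {p} q-closer p<q with closer? A p
  ... | no ¬closer  = slot-mono-<-nonCloser ¬closer p<q
  ... | yes p-closer = ≤-<-trans (slot-mono-≤ (n≤1+n p))
    (slot-mono-<-nonCloser (noAdjacentClosers p-closer)
      (≤∧≢⇒< p<q λ { refl → noAdjacentClosers p-closer q-closer }))

  slot-injective-nonCloser : ∀ {p q} → ¬ Closer A p → ¬ Closer A q → slot p ≡ slot q → p ≡ q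
  slot-injective-nonCloser {p} {q} ¬p ¬q eq with <-cmp p q
  ... | tri< p<q _ _ = contradiction eq (<⇒≢ (slot-mono-<-nonCloser ¬p p<q))
  ... | tri≈ _ p≡q _ = p≡q
  ... | tri> _ _ q<p = contradiction (sym eq) (<⇒≢ (slot-mono-<-nonCloser ¬q q<p))

  slot-injective-closer : ∀ {p q} → Closer A p → Closer A q → slot p ≡ slot q → p ≡ q
  slot-injective-closer {p} {q} p-closer q-closer eq with <-cmp p q
  ... | tri< p<q _ _ = contradiction eq (<⇒≢ (slot-mono-<-closer q-closer p<q))
  ... | tri≈ _ p≡q _ = p≡q
  ... | tri> _ _ q<p = contradiction (sym eq) (<⇒≢ (slot-mono-<-closer p-closer q<p))

module _ (M : SparseMatching (n + k) k) where
  private A = arcDiagram M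
  open ArcDiagram A using (_⌢_)

  -- Removing `k` closers from `n + k` vertices leaves `n` non-closers, so slots run up to `n`. Slot
  -- `n` is the appended isolated vertex; it is reached only by a closer at the very end.
  slot-bounded : ∀ {q} → q < n + k → slot M q < suc n
  slot-bounded q<m = s≤s (≤-trans (slot-mono-≤ M (<⇒≤ q<m)) (≤-reflexive slot-total))
    where
    slot-total : slot M (n + k) ≡ n
    slot-total = +-cancelʳ-≡ k _ n
      (trans (cong (slot M (n + k) +_) (sym (SparseMatching.closerCount M))) (count-∁ (closer? A) (n + k)))

  glue : ArcDiagram (suc n)
  glue = record
    { _⌢_           = λ u v → ∃[ p ] ∃[ q ] p ⌢ q × slot M p ≡ u × slot M q ≡ v
    ; closer?       = λ v → map′
        (λ (q , _ , (p , arc) , eq) → slot M p , p , q , arc , refl , eq)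
        (λ (_ , p , q , arc , _ , eq) → q , bounded A arc , (p , arc) , eq)
        (anyUpTo? (λ q → closer? A q ×-dec slot M q ≟ v) (n + k))
    ; increasing    = λ { (_ , _ , arc , refl , refl) →
        slot-mono-<-nonCloser M (source⇒nonCloser M arc) (increasing A arc) }
    ; bounded       = λ { (_ , _ , arc , _ , refl) → slot-bounded (bounded A arc) }
    -- A slot holds at most one closer and at most one non-closer, and every source is a non-closer;
    -- so arcs sharing a source or a target after gluing already shared it before.
    ; source-unique = λ { (_ , _ , arc , refl , refl) (_ , _ , arc′ , refl , eq) →
        cong (slot M) (source-unique A arc
          (subst (_ ⌢_) (slot-injective-closer M (_ , arc′) (_ , arc) eq) arc′)) }
    ; target-unique = λ { (_ , _ , arc , refl , refl) (_ , _ , arc′ , eq , refl) →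
        cong (slot M) (target-unique A arc
          (subst (_⌢ _) (slot-injective-nonCloser M (source⇒nonCloser M arc′) (source⇒nonCloser M arc) eq) arc′)) }
    }

  glue-closer⁺ : ∀ {q} → Closer A q → Closer glue (slot M q)
  glue-closer⁺ (_ , arc) = _ , _ , _ , arc , refl , refl

  glue-closer⁻ : ∀ {v} → Closer glue v → ∃[ q ] Closer A q × slot M q ≡ v
  glue-closer⁻ (_ , _ , q , arc , _ , eq) = q , (_ , arc) , eq

  #closers-glue : #closers glue ≡ k
  #closers-glue = trans
    (sym (count-bijection (closer? A) (closer? glue) (slot M)
      (λ q<m closer → slot-bounded q<m , glue-closer⁺ closer)
      (λ { _ (_ , _ , q , arc , _ , eq) → q , bounded A arc , (_ , arc) , eq })
      (slot-injective-closer M)))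
    (SparseMatching.closerCount M)

-- Injectivity of gluing

slot-cong : (M M′ : SparseMatching m k) → ∀ p →
  (∀ {i} → i < p → Closer (arcDiagram M) i ⇔ Closer (arcDiagram M′) i) → slot M p ≡ slot M′ p
slot-cong M M′ p closer⇔ = count-cong (∁? (closer? (arcDiagram M))) (∁? (closer? (arcDiagram M′))) p λ i<p →
  mk⇔ (λ ¬c c′ → ¬c (from (closer⇔ i<p) c′)) (λ ¬c′ c → ¬c′ (to (closer⇔ i<p) c))

glue-cong-⊆ : (M M′ : SparseMatching (n + k) k) → arcDiagram M ≋ arcDiagram M′ →
  ∀ {u v} → ArcDiagram._⌢_ (glue M) u v → ArcDiagram._⌢_ (glue M′) u v
glue-cong-⊆ M M′ eq (p , q , arc , eqᵘ , eqᵛ) = p , q , to eq arc , trans (sym (slot≡ p)) eqᵘ , trans (sym (slot≡ q)) eqᵛ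
  where
  slot≡ : ∀ i → slot M i ≡ slot M′ i
  slot≡ i = slot-cong M M′ i λ _ → closer-cong (arcDiagram M) (arcDiagram M′) eq

glue-cong : (M M′ : SparseMatching (n + k) k) → arcDiagram M ≋ arcDiagram M′ → glue M ≋ glue M′
glue-cong M M′ eq = mk⇔ (glue-cong-⊆ M M′ eq) (glue-cong-⊆ M′ M (≋-sym {A = arcDiagram M} {arcDiagram M′} eq))

-- If the closers below p agree, then so do the slots up to p, and a closer of M′
-- lying in the slot of p can only be p itself.
glue-closer-⊆ : (M M′ : SparseMatching (n + k) k) → glue M ≋ glue M′ → ∀ {p} →
  (∀ {i} → i < p → Closer (arcDiagram M) i ⇔ Closer (arcDiagram M′) i) →
  Closer (arcDiagram M) p → Closer (arcDiagram M′) p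
glue-closer-⊆ M M′ eq {p} below closer
  with glue-closer⁻ M′ (to (closer-cong (glue M) (glue M′) eq) (glue-closer⁺ M closer))
... | q , closer′ , slot≡ with <-cmp p q
... | tri≈ _ refl _ = closer′
... | tri< p<q _ _ = contradiction (trans slot≡ (slot-cong M M′ p below)) (>⇒≢ (slot-mono-<-closer M′ closer′ p<q))
... | tri> _ _ q<p = contradiction (trans (slot-cong M M′ q (below ∘ λ i<q → <-trans i<q q<p)) slot≡)
                                   (<⇒≢ (slot-mono-<-closer M closer q<p))

-- Strong induction from the left: the glued diagram determines the closers one vertex at a time.
glue-closers : (M M′ : SparseMatching (n + k) k) → glue M ≋ glue M′ → ∀ {p} → Acc _<_ p →
  Closer (arcDiagram M) p ⇔ Closer (arcDiagram M′) p
glue-closers M M′ eq (acc rec) =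
  mk⇔ (glue-closer-⊆ M M′ eq (λ i<p → glue-closers M M′ eq (rec i<p)))
      (glue-closer-⊆ M′ M (≋-sym {A = glue M} {glue M′} eq)
        (λ i<p → glue-closers M′ M (≋-sym {A = glue M} {glue M′} eq) (rec i<p)))

-- Once the closers agree, so do the slot functions, and each end of an arc is recovered from its
-- slot together with its kind, non-closer for the source and closer for the target.
glue-injective-⊆ : (M M′ : SparseMatching (n + k) k) → glue M ≋ glue M′ →
  ∀ {p q} → ArcDiagram._⌢_ (arcDiagram M) p q → ArcDiagram._⌢_ (arcDiagram M′) p q
glue-injective-⊆ M M′ eq {p} {q} arc with to eq (_ , _ , arc , refl , refl)
... | p′ , q′ , arc′ , eqˢ , eqᵗ = subst₂ (ArcDiagram._⌢_ (arcDiagram M′))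
  (slot-injective-nonCloser M′ (source⇒nonCloser M′ arc′)
    (source⇒nonCloser M arc ∘ from (closers _)) (trans eqˢ (slot≡ p)))
  (slot-injective-closer M′ (_ , arc′) (to (closers _) (_ , arc)) (trans eqᵗ (slot≡ q)))
  arc′
  where
  closers : ∀ i → Closer (arcDiagram M) i ⇔ Closer (arcDiagram M′) i
  closers i = glue-closers M M′ eq (<-wellFounded i)

  slot≡ : ∀ i → slot M i ≡ slot M′ i
  slot≡ i = slot-cong M M′ i λ _ → closers _

glue-injective : (M M′ : SparseMatching (n + k) k) → glue M ≋ glue M′ → arcDiagram M ≋ arcDiagram M′
glue-injective M M′ eq =
  mk⇔ (glue-injective-⊆ M M′ eq) (glue-injective-⊆ M′ M (≋-sym {A = glue M} {glue M′} eq))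

-- Splitting the vertices of a diagram into closers and openers

module _ (B : ArcDiagram (suc n)) where
  open ArcDiagram B using (_⌢_)

  -- Each closing vertex before `v` has become two, which shifts `v` to the right. `openerPosition`
  -- also counts the vertex itself, so the opener half comes immediately after the closer half of a
  -- closing vertex, and the two positions coincide otherwise.
  closerPosition : ℕ → ℕ
  closerPosition v = v + count (closer? B) v

  openerPosition : ℕ → ℕ
  openerPosition u = u + count (closer? B) (suc u)

  closer≤opener : ∀ v → closerPosition v ≤ openerPosition v
  closer≤opener v = +-monoʳ-≤ v (count-≤-suc (closer? B) v)

  opener≡1+closer : ∀ {v} → Closer B v → openerPosition v ≡ suc (closerPosition v)
  opener≡1+closer closer = trans (cong (_ +_) (count-accept (closer? B) closer)) (+-suc _ _)

  opener<closer : ∀ {u v} → u < v → openerPosition u < closerPosition v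
  opener<closer u<v = +-mono-<-≤ u<v (count-mono-≤ (closer? B) u<v)

  opener<closer⁻¹ : ∀ {u v} → openerPosition u < closerPosition v → u < v
  opener<closer⁻¹ lt = ≰⇒> λ v≤u → <⇒≱ lt (+-mono-≤ v≤u (count-mono-≤ (closer? B) (m≤n⇒m≤1+n v≤u)))

  closer-mono-< : ∀ {u v} → u < v → closerPosition u < closerPosition v
  closer-mono-< u<v = ≤-<-trans (closer≤opener _) (opener<closer u<v)

  closer-cancel-< : ∀ {u v} → closerPosition u < closerPosition v → u < v
  closer-cancel-< lt = ≰⇒> λ v≤u → <⇒≱ lt (+-mono-≤ v≤u (count-mono-≤ (closer? B) v≤u))

  closer-injective : ∀ {u v} → closerPosition u ≡ closerPosition v → u ≡ v
  closer-injective {u} {v} eq with <-cmp u v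
  ... | tri< u<v _ _ = contradiction eq (<⇒≢ (closer-mono-< u<v))
  ... | tri≈ _ u≡v _ = u≡v
  ... | tri> _ _ v<u = contradiction (sym eq) (<⇒≢ (closer-mono-< v<u))

  opener-cancel-< : ∀ {u v} → openerPosition u < openerPosition v → u < v
  opener-cancel-< lt = ≰⇒> λ v≤u → <⇒≱ lt (+-mono-≤ v≤u (count-mono-≤ (closer? B) (s≤s v≤u)))

  opener-injective : ∀ {u v} → openerPosition u ≡ openerPosition v → u ≡ v
  opener-injective {u} {v} eq with <-cmp u v
  ... | tri< u<v _ _ = contradiction eq (<⇒≢ (<-≤-trans (opener<closer u<v) (closer≤opener v)))
  ... | tri≈ _ u≡v _ = u≡v
  ... | tri> _ _ v<u = contradiction (sym eq) (<⇒≢ (<-≤-trans (opener<closer v<u) (closer≤opener u)))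

  -- For `u < v` the opener half of `u` lies before the closer half of `v`; for `v ≤ u` it lies at
  -- or after the opener half of `v`, which is one past the closer half.
  closer≢opener : ∀ {u v} → Closer B v → closerPosition v ≢ openerPosition u
  closer≢opener {u} {v} closer eq with u <? v
  ... | yes u<v = <⇒≢ (opener<closer u<v) (sym eq)
  ... | no  u≮v = 1+n≰n (≤-trans (≤-reflexive (sym (opener≡1+closer closer)))
    (≤-trans (+-mono-≤ (≮⇒≥ u≮v) (count-mono-≤ (closer? B) (s≤s (≮⇒≥ u≮v)))) (≤-reflexive (sym eq))))

  -- Splitting yields one vertex more than `n + #closers B`; the surplus one is the opener half of
  -- the last vertex, at position `n + #closers B`. A closer half lies one before its opener half,
  -- hence strictly below that position.
  closer-bounded : ∀ {v} → v < suc n → Closer B v → closerPosition v < n + #closers B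
  closer-bounded v<1+n closer =
    subst (_≤ n + #closers B) (opener≡1+closer closer) (+-mono-≤ (s≤s⁻¹ v<1+n) (count-mono-≤ (closer? B) v<1+n))

  module _ (#closers≡k : #closers B ≡ k) where

    split-bounded : ∀ {v} → v < suc n → Closer B v → closerPosition v < n + k
    split-bounded v<1+n closer = subst (λ c → _ < n + c) #closers≡k (closer-bounded v<1+n closer)

    split : ArcDiagram (n + k)
    split = record
      { _⌢_           = λ p q → ∃[ u ] ∃[ v ] u ⌢ v × openerPosition u ≡ p × closerPosition v ≡ q
      ; closer?       = λ q → map′
          (λ (v , _ , (u , arc) , eq) → openerPosition u , u , v , arc , refl , eq)
          (λ (_ , u , v , arc , _ , eq) → v , bounded B arc , (u , arc) , eq)
          (anyUpTo? (λ v → closer? B v ×-dec closerPosition v ≟ q) (suc n))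
      ; increasing    = λ { (_ , _ , arc , refl , refl) → opener<closer (increasing B arc) }
      ; bounded       = λ { (_ , _ , arc , _ , refl) → split-bounded (bounded B arc) (_ , arc) }
      ; source-unique = λ { (_ , _ , arc , refl , refl) (_ , _ , arc′ , refl , eq) →
          cong openerPosition (source-unique B arc (subst (_ ⌢_) (closer-injective eq) arc′)) }
      ; target-unique = λ { (_ , _ , arc , refl , refl) (_ , _ , arc′ , eq , refl) →
          cong closerPosition (target-unique B arc (subst (_⌢ _) (opener-injective eq) arc′)) }
      }

    split-closer⁺ : ∀ {v} → Closer B v → Closer split (closerPosition v)
    split-closer⁺ (_ , arc) = _ , _ , _ , arc , refl , refl

    split-opener : ∀ u → ¬ Closer split (openerPosition u)
    split-opener u (_ , _ , v , arc , _ , eq) = closer≢opener (_ , arc) eq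

    splitMatching : SparseMatching (n + k) k
    splitMatching = record
      { arcDiagram        = split
      ; noTransient       = λ { arc (u , _ , _ , refl , _) → split-opener u (_ , arc) }
      ; noAdjacentClosers = λ { (_ , _ , v , arc , _ , refl) closer →
          split-opener v (subst (Closer split) (sym (opener≡1+closer (_ , arc))) closer) }
      ; closerCount       = trans (sym (count-bijection (closer? B) (closer? split) closerPosition
          (λ v<1+n closer → split-bounded v<1+n closer , split-closer⁺ closer)
          (λ { _ (_ , _ , v , arc , _ , eq) → v , bounded B arc , (_ , arc) , eq })
          (λ _ _ → closer-injective))) #closers≡k
      }

    -- Mutual induction along the positions: going from the opener half of `v` to
    -- `closerPosition (suc v)`, its immediate successor, passes one non-closer, while going from
    -- the closer half of `v` to its opener half passes a closer or does not move.
    slot-closer : ∀ v → slot splitMatching (closerPosition v) ≡ v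
    slot-opener : ∀ v → slot splitMatching (openerPosition v) ≡ v

    slot-closer zero    =
      trans (cong (slot splitMatching) (count-zero (closer? B))) (count-zero (∁? (closer? split)))
    slot-closer (suc v) =
      trans (slot-suc-nonCloser splitMatching (split-opener v)) (cong suc (slot-opener v))

    slot-opener v = by-cases (closer? B v)
      where
      by-cases : Dec (Closer B v) → slot splitMatching (openerPosition v) ≡ v
      by-cases (yes closer) = trans (cong (slot splitMatching) (opener≡1+closer closer))
        (trans (slot-suc-closer splitMatching (split-closer⁺ closer)) (slot-closer v))
      by-cases (no ¬closer) = trans
        (cong (λ c → slot splitMatching (v + c)) (count-reject (closer? B) ¬closer)) (slot-closer v)

    glue-split : glue splitMatching ≋ B
    glue-split = mk⇔
      (λ { (_ , _ , (u , v , arc , refl , refl) , refl , refl) →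
           subst₂ _⌢_ (sym (slot-opener u)) (sym (slot-closer v)) arc })
      (λ arc → _ , _ , (_ , _ , arc , refl , refl) , slot-opener _ , slot-closer _)

-- The bijection

sparseMatching : PElement m k → SparseMatching m k
sparseMatching {m} {k} M = record
  { arcDiagram        = diagram π
  ; noTransient       = λ { (_ , _ , arc , refl , refl) (_ , _ , arc′ , eq , refl) →
      noTransient arc (subst (λ j → Arc π j _) (toℕ-injective eq) arc′) }
  ; noAdjacentClosers = λ { (_ , _ , _ , arc , refl , refl) (_ , _ , _ , arc′ , refl , eq) →
      noAdjacentClosers arc arc′ eq }
  ; closerCount       = trans (sym (#arcs≡#closers (diagram π) π (diagram-represents π))) (PElement.arcCount M)
  }
  where
  π : SetPartition m
  π = PElement.partition M

  noTransient : ∀ {i j l} → Arc π i j → ¬ Arc π j l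
  noTransient = partialMatching⇒noTransient π (PElement.isPartialMatching M)

  -- Compare the sources of the two arcs: `i₁ < i₂` gives a crossing with closers at distance one,
  -- `i₂ < i₁` a right nesting, and equality contradicts target uniqueness.
  noAdjacentClosers : ∀ {i₁ j₁ i₂ j₂} → Arc π i₁ j₁ → Arc π i₂ j₂ → toℕ j₂ ≢ suc (toℕ j₁)
  noAdjacentClosers {i₁} {j₁} {i₂} {j₂}
    arc₁@(_ , _ , _ , _ , i₁<j₁ , _) arc₂@(_ , _ , _ , _ , i₂<j₂ , _) j₂≡1+j₁
    with <-cmp (toℕ i₁) (toℕ i₂)
  ... | tri< i₁<i₂ _ _ = PElement.no2RightCrossing M (i₁ , j₁ , i₂ , j₂ , arc₁ , arc₂ , i₁<i₂ , i₂<j₁ ,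
      ≤-reflexive (sym j₂≡1+j₁) ,
      ≤-trans (≤-reflexive (trans (cong (_∸ toℕ j₁) j₂≡1+j₁) (m+n∸n≡m 1 (toℕ j₁)))) (n≤1+n 1))
    where
    i₂<j₁ : toℕ i₂ < toℕ j₁
    -- From `j₂` being the successor of `j₁` only `i₂ ≤ j₁` follows; equality would make `j₁` a
    -- transient.
    i₂<j₁ = ≤∧≢⇒< (s≤s⁻¹ (subst (toℕ i₂ <_) j₂≡1+j₁ i₂<j₂))
                  (λ eq → noTransient arc₁ (subst (λ i → Arc π i j₂) (toℕ-injective eq) arc₂))
  ... | tri≈ _ eq _ with refl ← toℕ-injective eq with refl ← Arc-targetUnique π arc₁ arc₂ = 1+n≢n (sym j₂≡1+j₁)
  ... | tri> _ _ i₂<i₁ = PElement.noRightNesting M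
    (i₂ , j₂ , i₁ , j₁ , arc₂ , arc₁ , i₂<i₁ , i₁<j₁ , ≤-reflexive (sym j₂≡1+j₁) , j₂≡1+j₁)

toCT : ∀ n k → PElement (n + k) k → CTElement (suc n) k
toCT n k M = record
  { partition       = π
  ; arcCount        = trans (#arcs≡#closers (glue S) π (toPartition-represents (glue S))) (#closers-glue S)
  ; noRightCrossing = λ (_ , _ , _ , _ , arc₁ , arc₂ , i₁<i₂ , i₂<j₁ , _ , j₂≡1+j₁) →
      noCrossing (toPartition-arc⁻ (glue S) arc₁) (toPartition-arc⁻ (glue S) arc₂) i₁<i₂ i₂<j₁ j₂≡1+j₁
  }
  where
  S : SparseMatching (n + k) k
  S = sparseMatching M

  π : SetPartition (suc n)
  π = toPartition (glue S)

  -- Since `slot` is weakly monotone, strict inequalities between slots lift to the original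
  -- vertices, so a right crossing lifts to a crossing; its closers lie in consecutive slots and are
  -- therefore at most two apart.
  noCrossing : ∀ {u₁ v₁ u₂ v₂} → ArcDiagram._⌢_ (glue S) u₁ v₁ → ArcDiagram._⌢_ (glue S) u₂ v₂ →
    u₁ < u₂ → u₂ < v₁ → v₂ ≢ suc v₁
  noCrossing (_ , _ , (i₁ , j₁ , arc₁ , refl , refl) , refl , refl)
             (_ , _ , (i₂ , j₂ , arc₂ , refl , refl) , refl , refl) u₁<u₂ u₂<v₁ v₂≡1+v₁ =
    PElement.no2RightCrossing M (i₁ , j₁ , i₂ , j₂ , arc₁ , arc₂ ,
      slot-cancel-< S u₁<u₂ , slot-cancel-< S u₂<v₁ , slot-cancel-< S (≤-reflexive (sym v₂≡1+v₁)) ,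
      m≤n+o⇒m∸n≤o _ (toℕ j₁) (subst (toℕ j₂ ≤_) (+-comm 2 (toℕ j₁)) (≮⇒≥ j₂≯2+j₁)))
    where
    closer₁ : Closer (diagram (PElement.partition M)) (toℕ j₁)
    closer₁ = _ , _ , _ , arc₁ , refl , refl

    slot-2+j₁ : slot S (suc (suc (toℕ j₁))) ≡ suc (slot S (toℕ j₁))
    slot-2+j₁ = trans (slot-suc-nonCloser S (SparseMatching.noAdjacentClosers S closer₁))
                      (cong suc (slot-suc-closer S closer₁))

    -- Passing the closer `j₁` and the non-closer after it advances the slot by one, so a closer
    -- beyond distance two would lie in a later slot than `suc v₁`.
    j₂≯2+j₁ : ¬ (suc (suc (toℕ j₁)) < toℕ j₂)
    j₂≯2+j₁ lt = <⇒≢ (slot-mono-<-closer S (_ , _ , _ , arc₂ , refl , refl) lt) (trans slot-2+j₁ (sym v₂≡1+v₁))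

#closers-CT : (Y : CTElement n k) → #closers (diagram (CTElement.partition Y)) ≡ k
#closers-CT Y = trans (sym (#arcs≡#closers (diagram π) π (diagram-represents π))) (CTElement.arcCount Y)
  where π = CTElement.partition Y

fromCT : CTElement (suc n) k → PElement (n + k) k
fromCT {n} {k} Y = record
  { partition         = toPartition U
  ; isPartialMatching = noTransient⇒partialMatching (toPartition U) λ arc arc′ →
      SparseMatching.noTransient S (toPartition-arc⁻ U arc) (toPartition-arc⁻ U arc′)
  ; arcCount          = trans (#arcs≡#closers U (toPartition U) (toPartition-represents U)) (SparseMatching.closerCount S)
  ; no2RightCrossing  = λ (_ , _ , _ , _ , arc₁ , arc₂ , i₁<i₂ , i₂<j₁ , j₁<j₂ , j₂∸j₁≤2) →
      no2Crossing (toPartition-arc⁻ U arc₁) (toPartition-arc⁻ U arc₂) i₁<i₂ i₂<j₁ j₁<j₂ j₂∸j₁≤2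
  ; noRightNesting    = λ (_ , _ , _ , _ , arc₁ , arc₂ , _ , _ , _ , j₁≡1+j₂) →
      SparseMatching.noAdjacentClosers S (_ , toPartition-arc⁻ U arc₂)
        (subst (Closer U) j₁≡1+j₂ (_ , toPartition-arc⁻ U arc₁))
  }
  where
  B : ArcDiagram (suc n)
  B = diagram (CTElement.partition Y)

  S : SparseMatching (n + k) k
  S = splitMatching B (#closers-CT Y)

  U : ArcDiagram (n + k)
  U = arcDiagram S

  -- Positions reflect order, so the crossing descends to the given partition. If `v₂` were beyond
  -- `suc v₁`, both the opener half of `v₁` and `closerPosition` of `suc v₁` would separate the two
  -- closers, putting them at least three apart; so the crossing is a right crossing.
  no2Crossing : ∀ {p₁ q₁ p₂ q₂} → ArcDiagram._⌢_ U p₁ q₁ → ArcDiagram._⌢_ U p₂ q₂ →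
    p₁ < p₂ → p₂ < q₁ → q₁ < q₂ → ¬ (q₂ ∸ q₁ ≤ 2)
  no2Crossing (_ , _ , (u₁ , v₁ , arc₁ , refl , refl) , refl , refl)
              (_ , _ , (u₂ , v₂ , arc₂ , refl , refl) , refl , refl) p₁<p₂ p₂<q₁ q₁<q₂ q₂∸q₁≤2 =
    CTElement.noRightCrossing Y (u₁ , v₁ , u₂ , v₂ , arc₁ , arc₂ , opener-cancel-< B p₁<p₂ ,
      opener<closer⁻¹ B p₂<q₁ , closer-cancel-< B q₁<q₂ ,
      ≤-antisym (≮⇒≥ v₂≯1+v₁) (closer-cancel-< B q₁<q₂))
    where
    v₂≯1+v₁ : ¬ (suc (toℕ v₁) < toℕ v₂)
    v₂≯1+v₁ lt = <⇒≱ 2+q₁<q₂ q₂≤2+q₁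
      where
      q₁ = closerPosition B (toℕ v₁)
      q₂ = closerPosition B (toℕ v₂)

      2+q₁<q₂ : 2 + q₁ < q₂
      2+q₁<q₂ = ≤-<-trans
        (≤-<-trans (≤-reflexive (sym (opener≡1+closer B (_ , _ , _ , arc₁ , refl , refl)))) (opener<closer B ≤-refl))
        (closer-mono-< B lt)

      q₂≤2+q₁ : q₂ ≤ 2 + q₁
      q₂≤2+q₁ = ≤-trans (m≤n+m∸n q₂ q₁) (≤-trans (+-monoʳ-≤ q₁ q₂∸q₁≤2) (≤-reflexive (+-comm q₁ 2)))

toCT-cong : ∀ n k (M M′ : PElement (n + k) k) → IsBlock (PElement.partition M) ≐ IsBlock (PElement.partition M′) →
  IsBlock (CTElement.partition (toCT n k M)) ≐ IsBlock (CTElement.partition (toCT n k M′))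
toCT-cong n k M M′ π≈π′ = toPartition-cong (glue S) (glue S′)
  (glue-cong S S′ (diagram-cong (PElement.partition M) (PElement.partition M′) π≈π′))
  where
  S S′ : SparseMatching (n + k) k
  S = sparseMatching M
  S′ = sparseMatching M′

toCT-injective : ∀ n k (M M′ : PElement (n + k) k) →
  IsBlock (CTElement.partition (toCT n k M)) ≐ IsBlock (CTElement.partition (toCT n k M′)) →
  IsBlock (PElement.partition M) ≐ IsBlock (PElement.partition M′)
toCT-injective n k M M′ π≈π′ = diagram-injective (PElement.partition M) (PElement.partition M′)
  (glue-injective S S′ (toPartition-injective (glue S) (glue S′) π≈π′))
  where
  S S′ : SparseMatching (n + k) k
  S = sparseMatching M
  S′ = sparseMatching M′

toCT-fromCT : ∀ n k (Y : CTElement (suc n) k) →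
  IsBlock (CTElement.partition (toCT n k (fromCT Y))) ≐ IsBlock (CTElement.partition Y)
toCT-fromCT n k Y = diagram-injective (CTElement.partition (toCT n k M)) (CTElement.partition Y)
  (≋-trans {A = diagram (toPartition (glue S))} {glue S} {B}
    (≋-sym {A = glue S} {diagram (toPartition (glue S))} (toPartition-represents (glue S)))
    (≋-trans {A = glue S} {glue T} {B}
      -- `S` is read back from the partition built out of `T`, so their diagrams agree only up to
      -- `≋`.
      (glue-cong S T (≋-sym {A = arcDiagram T} {arcDiagram S} (toPartition-represents (arcDiagram T))))
      (glue-split B (#closers-CT Y))))
  where
  B = diagram (CTElement.partition Y)
  T = splitMatching B (#closers-CT Y)

  M : PElement (n + k) k
  M = fromCT Y

  S : SparseMatching (n + k) k
  S = sparseMatching M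

-- A closer and the vertex right after it share a slot, so an opener in that place makes the glued
-- vertex both the target and the source of an arc.
neighborAlignments≡transients : ∀ n k (M : PElement (n + k) k) →
  #neighborAlignments (PElement.partition M) ≡ #transients (CTElement.partition (toCT n k M))
neighborAlignments≡transients n k M = alignmentBijection (PElement.partition M) (CTElement.partition (toCT n k M)) (slot S) alignment⇒transient transient⇒alignment
  (λ arc arc′ eq → toℕ-injective (slot-injective-closer S (closer arc) (closer arc′) eq))
  where
  π : SetPartition (n + k)
  π = PElement.partition M

  S : SparseMatching (n + k) k
  S = sparseMatching M

  π′ : SetPartition (suc n)
  π′ = toPartition (glue S)

  closer : ∀ {i j} → Arc π i j → Closer (diagram π) (toℕ j)
  closer arc = _ , _ , _ , arc , refl , refl

  nonCloser : ∀ {i j} → Arc π i j → ¬ Closer (diagram π) (toℕ i)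
  nonCloser arc = source⇒nonCloser S (_ , _ , arc , refl , refl)

  glueArc : ∀ {i j} → Arc π i j → ∃[ u ] ∃[ v ] Arc π′ u v × toℕ u ≡ slot S (toℕ i) × toℕ v ≡ slot S (toℕ j)
  glueArc arc = to (toPartition-represents (glue S)) (_ , _ , (_ , _ , arc , refl , refl) , refl , refl)

  alignment⇒transient : ∀ {i₁ j₁ i₂ j₂} → Arc π i₁ j₁ → Arc π i₂ j₂ → toℕ i₂ ≡ suc (toℕ j₁) →
    ∃[ w ] Transient π′ w × slot S (toℕ j₁) ≡ toℕ w
  alignment⇒transient {j₁ = j₁} {i₂} arc₁ arc₂ i₂≡1+j₁ =
    let u , w , arc₁′ , _ , eq₁ = glueArc arc₁
        w′ , v , arc₂′ , eq₂ , _ = glueArc arc₂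
        w′≡w = toℕ-injective (trans eq₂ (trans slot≡ (sym eq₁)))
    in w , (u , v , arc₁′ , subst (λ x → Arc π′ x v) w′≡w arc₂′) , sym eq₁
    where
    slot≡ : slot S (toℕ i₂) ≡ slot S (toℕ j₁)
    slot≡ = trans (cong (slot S) i₂≡1+j₁) (slot-suc-closer S (closer arc₁))

  transient⇒alignment : ∀ {w} → Transient π′ w → ∃[ i₁ ] ∃[ j₁ ] ∃[ i₂ ] ∃[ j₂ ]
    Arc π i₁ j₁ × Arc π i₂ j₂ × toℕ i₂ ≡ suc (toℕ j₁) × slot S (toℕ j₁) ≡ toℕ w
  transient⇒alignment (_ , _ , arc₁′ , arc₂′)
    with _ , _ , (i₁ , j₁ , arc₁ , refl , refl) , _ , eq₁ ← toPartition-arc⁻ (glue S) arc₁′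
    with _ , _ , (i₂ , j₂ , arc₂ , refl , refl) , eq₂ , _ ← toPartition-arc⁻ (glue S) arc₂′ =
    i₁ , j₁ , i₂ , j₂ , arc₁ , arc₂ ,
    -- Both `i₂` and the successor of `j₁` are non-closers in the slot of `j₁`, hence equal.
    slot-injective-nonCloser S (nonCloser arc₂) (SparseMatching.noAdjacentClosers S (closer arc₁))
      (trans eq₂ (trans (sym eq₁) (sym (slot-suc-closer S (closer arc₁))))) ,
    eq₁

theorem3p1 : ∀ (n k : ℕ) → 1 ≤ n → k ≤ n ∸ 1 →
    Σ[ φ ∈ Bijection (𝒫 (n + k ∸ 1) k) (𝒞𝒯 n k) ]
    (∀ (M : PElement (n + k ∸ 1) k) →
    #neighborAlignments (PElement.partition M)
    ≡ #transients (CTElement.partition (Bijection.to φ M)))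
-- With `suc n` in place of `n`, the number of vertices `n + k ∸ 1` computes to `n + k`.
theorem3p1 (suc n) k _ _ = record
  { to        = toCT n k
  ; cong      = λ {M} {M′} → toCT-cong n k M M′
  ; bijective = (λ {M} {M′} → toCT-injective n k M M′) ,
                -- Surjectivity quantifies over every `M` equal to the preimage as a partition, so
                -- congruence moves from `M` to `fromCT Y` first.
                λ Y → fromCT Y , λ {M} M≈ → ≐-trans (toCT-cong n k M (fromCT Y) M≈) (toCT-fromCT n k Y)
  } , neighborAlignments≡transients n k
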